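{- Let $L$ be the star fork, the subfork, or the dot, and let $K,K'$ be proper pseudohexes such that $K$ is obtained from $K'$ by $L$-addition. Then $L_K$ can be safely reduced.
   Context: Pseudohex. A pseudohex is a bipartite graph $K$ (parallel edges allowed, no loops) whose edges are coloured blue, red and white, which is either empty or satisfies: (i) the blue edges form vertex-disjoint 6-cycles covering $V(K)$, called the hexagons of $K$; if a hexagon is the 6-cycle $v_0v_1\cdots v_5v_0$ we write $\bar{v_i}=v_{i+3}$ (indices mod 6); (ii) for each vertex $x$, $\{x,\bar x\}$ is a red edge of $K$ (further red edges may exist); (iii) the white edges form a perfect matching of $K$. A white edge $e=\{x,y\}$ is real if $\bar e=\{\bar x,\bar y\}$ is also a white edge and the only red edges sharing a vertex with $e$ or $\bar e$ are $\{x,\bar x\}$ and $\{y,\bar y\}$; non-real white edges are derived. An end is a red edge parallel to a white edge. $G^K$ is the graph whose vertices are the hexagons of $K$, two hexagons being adjacent iff some pair of real white edges $e,\bar e$ joins them. $K$ is proper if it has no end and $G^K$ is 2-connected with no cycle of length 2. Reduction. Let $h$ be a hexagon and $N$ one of the two perfect matchings of its blue 6-cycle. For each edge of $N$, let $P$ be the path formed by that edge and the two white edges adjacent to it. If $P$ is not a cycle of length 2, add a new white edge $e_P$ joining the end vertices of $P$, and for each red edge $\{u,w\}$ with $w$ an interior vertex of $P$ add a red edge $\{u,w'\}$ where $w'$ is the endpoint of $e_P$ in the same bipartition class as $w$. If $P$ is a cycle of length 2, then for each red edge $\{u,w\}$ with $w$ an interior vertex of $P$ add a red edge $\{u,\bar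 u\}$. Finally delete the vertices of $h$. Reducing hexagons $h_1,\dots,h_l$ by perfect matchings $N_1,\dots,N_l$ means performing these reductions successively; its contracted paths are the components (paths and cycles) of the subgraph of $K$ formed by $N_1\cup\dots\cup N_l$ together with all white edges having an endpoint in $V(h_1)\cup\dots\cup V(h_l)$. The reduction is safe if every contracted path/cycle contains at most one derived white edge of $K$; a set of hexagons can be safely reduced if some choice of perfect matchings gives a safe reduction. Fork-type graphs and addition. The star fork is $K_{1,3}$; the bold star fork has one half-edge at each of its three leaves. The subfork is a single edge (two vertices); the bold subfork has one half-edge at each of its two vertices. The dot is a single vertex; a bold dot has two or three half-edges attached to it. A graph is obtained from $G'$ by addition of the bold $L$ if it is obtained from the disjoint union of $G'$ and $L$ by joining each half-edge of the bold $L$ to a distinct vertex of degree 2 of $G'$. $K$ is obtained from $K'$ by $L$-addition if $G^K$ is obtained from $G^{K'}$ by addition of the bold $L$; $L_K$ is the set of hexagons of $K$ corresponding to the vertices of $L$. -}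

module Defs where

open import Level using (0ℓ)
open import Data.Bool using (Bool)
open import Data.Nat using (ℕ; _+_)
open import Data.Nat.DivMod using (_mod_)
open import Data.Fin using (Fin; zero; suc; toℕ)
open import Data.Fin.Subset using (Subset; _∈_)
open import Data.List using (List; length)
import Data.List.Membership.Propositional as ListMem
open import Data.List.Relation.Unary.Unique.Propositional using (Unique)
open import Data.Product using (Σ; ∃; ∃!; ∃-syntax; _×_; _,_; proj₁; proj₂)
open import Data.Sum using (_⊎_; inj₁; inj₂)
open import Data.Empty using (⊥)
open import Function.Bundles using (_↔_; _⇔_; Inverse)
open import Function.Definitions using (Injective)
open import Relation.Nullary using (¬_)
open import Relation.Unary using (Pred)
open import Relation.Binary using (Rel; Symmetric; Irreflexive)
open import Relation.Binary.Construct.Closure.ReflexiveTransitive using (Star)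
open import Relation.Binary.PropositionalEquality using (_≡_; _≢_; refl; sym)

------------------------------------------------------------------------
-- Simple graphs

record Graph : Set₁ where
  infix 4 _~_
  field
    Vertex   : Set
    _~_      : Rel Vertex 0ℓ
    ~-sym    : Symmetric _~_
    ~-irrefl : Irreflexive _≡_ _~_

module _ (G : Graph) where
  open Graph G

  HasDegree : Vertex → ℕ → Set
  HasDegree v d = Σ (List Vertex) λ xs →
    length xs ≡ d × Unique xs × (∀ u → v ~ u ⇔ u ListMem.∈ xs)

  Connected : Set
  Connected = ∀ u v → Star _~_ u v

  -- G - w is connected
  ConnectedWithout : Vertex → Set
  ConnectedWithout w = ∀ u v → u ≢ w → v ≢ w →
    Star (λ a b → a ~ b × a ≢ w × b ≢ w) u v

  -- At least three vertices, connected, and no cut vertex.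
  TwoConnected : Set
  TwoConnected =
    (∃[ f ] Injective {A = Fin 3} {B = Vertex} _≡_ _≡_ f) ×
    Connected × (∀ w → ConnectedWithout w)

record _≅_ (G H : Graph) : Set where
  private
    module G = Graph G
    module H = Graph H
  field
    vertices  : G.Vertex ↔ H.Vertex
  open Inverse vertices using (to) public
  field
    adjacency : ∀ u v → (u G.~ v) ⇔ (to u H.~ to v)

------------------------------------------------------------------------
-- Graphs with half-edges, and their addition to a graph

record HalfEdges (L : Graph) : Set where
  field
    count : ℕ
    at    : Fin count → Graph.Vertex L

-- The disjoint union of G′ and L, with half-edge j joined to the vertex
-- attach j of G′.
join : (G′ L : Graph) (B : HalfEdges L) →
       (Fin (HalfEdges.count B) → Graph.Vertex G′) → Graph
join G′ L B attach = record
  { Vertex   = G′.Vertex ⊎ L.Vertex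
  ; _~_      = adj
  ; ~-sym    = λ {x} {y} → adj-sym x y
  ; ~-irrefl = λ {x} {y} → adj-irrefl x y
  }
  where
  module G′ = Graph G′
  module L = Graph L
  open HalfEdges B

  cross : G′.Vertex → L.Vertex → Set
  cross u l = ∃[ j ] (attach j ≡ u × at j ≡ l)

  adj : Rel (G′.Vertex ⊎ L.Vertex) 0ℓ
  adj (inj₁ u) (inj₁ v) = u G′.~ v
  adj (inj₁ u) (inj₂ l) = cross u l
  adj (inj₂ l) (inj₁ u) = cross u l
  adj (inj₂ l) (inj₂ m) = l L.~ m

  adj-sym : ∀ x y → adj x y → adj y x
  adj-sym (inj₁ u) (inj₁ v) p = G′.~-sym p
  adj-sym (inj₁ u) (inj₂ l) p = p
  adj-sym (inj₂ l) (inj₁ u) p = p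
  adj-sym (inj₂ l) (inj₂ m) p = L.~-sym p

  adj-irrefl : ∀ x y → x ≡ y → ¬ adj x y
  adj-irrefl (inj₁ u) .(inj₁ u) refl p = G′.~-irrefl refl p
  adj-irrefl (inj₂ l) .(inj₂ l) refl p = L.~-irrefl refl p

record Addition (G′ L : Graph) (B : HalfEdges L) (G : Graph) : Set where
  open HalfEdges B using (count)
  field
    attach     : Fin count → Graph.Vertex G′
    distinct   : Injective _≡_ _≡_ attach
    degree-two : ∀ j → HasDegree G′ (attach j) 2
    iso        : join G′ L B attach ≅ G

data Fork : Set where
  starFork subfork dot : Fork

data StarAdj : Rel (Fin 4) 0ℓ where
  centre-leaf : ∀ i → StarAdj zero (suc i)
  leaf-centre : ∀ i → StarAdj (suc i) zero

forkGraph : Fork → Graph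
forkGraph starFork = record
  { Vertex   = Fin 4
  ; _~_      = StarAdj
  ; ~-sym    = λ { (centre-leaf i) → leaf-centre i
                 ; (leaf-centre i) → centre-leaf i }
  ; ~-irrefl = λ { refl () }
  }
forkGraph subfork = record
  { Vertex   = Fin 2
  ; _~_      = _≢_
  ; ~-sym    = λ p q → p (sym q)
  ; ~-irrefl = λ p q → q p
  }
forkGraph dot = record
  { Vertex   = Fin 1
  ; _~_      = λ _ _ → ⊥
  ; ~-sym    = λ ()
  ; ~-irrefl = λ _ ()
  }

data Bold : (L : Fork) → HalfEdges (forkGraph L) → Set where
  bold-starFork : Bold starFork (record { count = 3 ; at = suc })
  bold-subfork  : Bold subfork  (record { count = 2 ; at = λ i → i })
  bold-dot₂     : Bold dot      (record { count = 2 ; at = λ _ → zero })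
  bold-dot₃     : Bold dot      (record { count = 3 ; at = λ _ → zero })

------------------------------------------------------------------------
-- Pseudohexes

data Colour : Set where
  blue red white : Colour

-- Finite bipartite multigraphs with coloured edges; bipartiteness
-- excludes loops.
record ColouredGraph : Set where
  field
    #vertices #edges : ℕ

  Vertex : Set
  Vertex = Fin #vertices

  Edge : Set
  Edge = Fin #edges

  field
    end₁ end₂ : Edge → Vertex
    colour    : Edge → Colour
    side      : Vertex → Bool
    bipartite : ∀ e → side (end₁ e) ≢ side (end₂ e)

  Joins : Edge → Vertex → Vertex → Set
  Joins e x y = (end₁ e ≡ x × end₂ e ≡ y) ⊎ (end₁ e ≡ y × end₂ e ≡ x)

  Incident : Vertex → Edge → Set
  Incident x e = end₁ e ≡ x ⊎ end₂ e ≡ x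

  ShareVertex : Edge → Edge → Set
  ShareVertex e f = ∃[ x ] (Incident x e × Incident x f)

  Blue Red White : Edge → Set
  Blue  e = colour e ≡ blue
  Red   e = colour e ≡ red
  White e = colour e ≡ white

  Parallel : Edge → Edge → Set
  Parallel e f = Joins e (end₁ f) (end₂ f)

shift : ℕ → Fin 6 → Fin 6
shift d i = (toℕ i + d) mod 6

-- The empty pseudohex is the case #hexagons = 0.
record Pseudohex : Set where
  field
    graph : ColouredGraph
  open ColouredGraph graph public

  field
    #hexagons : ℕ

  Hexagon : Set
  Hexagon = Fin #hexagons

  field
    -- (h , i) corresponds to the i-th vertex of the 6-cycle h.
    labelling : (Hexagon × Fin 6) ↔ Vertex

  vertexAt : Hexagon → Fin 6 → Vertex
  vertexAt h i = Inverse.to labelling (h , i)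

  hexagonOf : Vertex → Hexagon
  hexagonOf x = proj₁ (Inverse.from labelling x)

  indexOf : Vertex → Fin 6
  indexOf x = proj₂ (Inverse.from labelling x)

  bar : Vertex → Vertex
  bar x = vertexAt (hexagonOf x) (shift 3 (indexOf x))

  field
    blue-cycles : ∀ h i →
      ∃! _≡_ λ e → Blue e × Joins e (vertexAt h i) (vertexAt h (shift 1 i))
    blue-only   : ∀ e → Blue e →
      ∃[ h ] ∃[ i ] Joins e (vertexAt h i) (vertexAt h (shift 1 i))
    red-bar     : ∀ x → ∃[ e ] (Red e × Joins e x (bar x))
    white-perfect-matching : ∀ x → ∃! _≡_ λ e → White e × Incident x e

module _ (K : Pseudohex) where
  open Pseudohex K

  -- f = ē
  IsBar : Edge → Edge → Set
  IsBar e f = Joins f (bar (end₁ e)) (bar (end₂ e))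

  -- Edges are identified with their sets of ends in "the only red edges
  -- are {x , x̄} and {y , ȳ}": parallel copies of these two are allowed.
  Real : Edge → Set
  Real e = White e × ∃[ f ] (White f × IsBar e f ×
    (∀ r → Red r → ShareVertex r e ⊎ ShareVertex r f →
       Joins r (end₁ e) (bar (end₁ e)) ⊎ Joins r (end₂ e) (bar (end₂ e))))

  Derived : Edge → Set
  Derived e = White e × ¬ Real e

  JoinsHexagons : Edge → Hexagon → Hexagon → Set
  JoinsHexagons e h h′ = ∃[ x ] ∃[ y ]
    (hexagonOf x ≡ h × hexagonOf y ≡ h′ × Joins e x y)

  hexGraph : Graph
  hexGraph = record
    { Vertex   = Hexagon
    ; _~_      = λ h h′ → h ≢ h′ × ∃[ e ] (Real e × JoinsHexagons e h h′)
    ; ~-sym    = λ { (h≢h′ , e , e-real , x , y , p , q , e-xy) →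
                     (λ h′≡h → h≢h′ (sym h′≡h)) ,
                     e , e-real , y , x , q , p , swap e-xy }
    ; ~-irrefl = λ h≡h′ h~h′ → proj₁ h~h′ h≡h′
    }
    where
    swap : ∀ {e x y} → Joins e x y → Joins e y x
    swap (inj₁ p) = inj₂ p
    swap (inj₂ p) = inj₁ p

  -- A cycle of length 2, when every pair {e , ē} of real white edges
  -- joining two hexagons is counted as one edge of hexGraph.
  TwoCycle : Set
  TwoCycle = ∃[ h ] ∃[ h′ ] ∃[ e ] ∃[ f ]
    (h ≢ h′ × Real e × Real f ×
     JoinsHexagons e h h′ × JoinsHexagons f h h′ ×
     e ≢ f × ¬ IsBar e f)

  End : Edge → Set
  End r = Red r × ∃[ e ] (White e × Parallel r e)

  Proper : Set
  Proper = (∀ r → ¬ End r) × TwoConnected hexGraph × ¬ TwoCycle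

  -- M is a perfect matching of the blue 6-cycle h.
  PerfectMatchingOf : Hexagon → Subset #edges → Set
  PerfectMatchingOf h M =
    (∀ e → e ∈ M → Blue e × hexagonOf (end₁ e) ≡ h × hexagonOf (end₂ e) ≡ h) ×
    (∀ x → hexagonOf x ≡ h → ∃! _≡_ λ e → e ∈ M × Incident x e)

  module _ (S : Pred Hexagon 0ℓ) (N : Hexagon → Subset #edges) where

    -- The subgraph whose components are the contracted paths and cycles;
    -- only the values of N on S matter.
    Contracted : Edge → Set
    Contracted e =
      (∃[ h ] (S h × e ∈ N h)) ⊎
      (White e × ∃[ x ] (S (hexagonOf x) × Incident x e))

    -- For contracted edges e and f.
    SameComponent : Edge → Edge → Set
    SameComponent e f =
      Star (λ x y → ∃[ g ] (Contracted g × Joins g x y)) (end₁ e) (end₁ f)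

    SafeReduction : Set
    SafeReduction =
      (∀ h → S h → PerfectMatchingOf h (N h)) ×
      (∀ e f → Contracted e → Contracted f → Derived e → Derived f →
         SameComponent e f → e ≡ f)

  CanBeSafelyReduced : Pred Hexagon 0ℓ → Set
  CanBeSafelyReduced S = ∃[ N ] SafeReduction S N

------------------------------------------------------------------------
-- L-addition

record ForkAddition (L : Fork) (K K′ : Pseudohex) : Set where
  field
    halfEdges : HalfEdges (forkGraph L)
    bold      : Bold L halfEdges
    addition  : Addition (hexGraph K′) (forkGraph L) halfEdges (hexGraph K)

  -- L_K
  addedHexagons : Pred (Pseudohex.Hexagon K) 0ℓ
  addedHexagons h = ∃[ l ] _≅_.to (Addition.iso addition) (inj₂ l) ≡ h

{-# OPTIONS --safe #-}
-- Call the two white edges at an antipodal pair of vertices of a hexagon a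
-- class.  Each hexagon of L has a class of real edges for each of its
-- neighbours, so every hexagon but the centre of the star fork has at most
-- one class, its stubs, that may be derived.  Number the vertices of each
-- hexagon (up to rotation and reflection) so that N is {01, 23, 45}.  In a
-- hexagon other than the centre put the stubs at 1 and 4, a class leaving L
-- at 2 and 5, and the remaining class at 0 and 3; then N cuts the hexagon into
-- the pieces 0-1 and 4-5, containing a stub, and 2-3, containing none.  The
-- remaining class is glued so that every piece 2-3 is continued to exactly one
-- piece 0-1: in the subfork 0 meets 3, and in the star fork 0 and 3 of leaf m
-- meet 2m and 2m + 3 of the centre.  Hence every chain of edges of N and real
-- edges has exactly one stub, and a derived edge can only join two such chains
-- at their stubs.
module Submission where

open import Defs

open import Data.Empty using (⊥-elim)
open import Data.Fin using (Fin; suc; toℕ; _≟_)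
open import Data.Fin.Patterns using (0F; 1F; 2F; 3F; 4F; 5F)
open import Data.Fin.Properties using (all?; any?; suc-injective)
open import Data.Fin.Subset using (Subset; _∈_)
open import Data.Nat using (ℕ; _∸_)
open import Data.Product using (∃-syntax; _×_; _,_; proj₁; proj₂; uncurry)
open import Data.Sum using (_⊎_; inj₁; inj₂; swap)
import Data.Sum as Sum
open import Data.Sum.Properties using (inj₁-injective)
open import Data.Vec using (tabulate)
open import Data.Vec.Properties using (lookup∘tabulate; lookup⇒[]=; []=⇒lookup)
open import Function.Bundles using (Inverse; Equivalence)
open import Function.Definitions using (Injective)
open import Relation.Binary.Construct.Closure.ReflexiveTransitive using (Star; ε; _◅_)
open import Relation.Binary.PropositionalEquality
  using (_≡_; _≢_; refl; sym; trans; cong; cong₂; subst; subst₂)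
open import Relation.Nullary using (¬_; Dec; yes; no; does; contradiction)
open import Relation.Nullary.Decidable
  using (from-yes; dec-true; ¬?; _×-dec_; _⊎-dec_; _→-dec_)

-- Framings of a hexagon

Apart : Fin 6 → Fin 6 → Set
Apart i j = j ≢ i × j ≢ shift 3 i

apart? : ∀ i j → Dec (Apart i j)
apart? i j = ¬? (j ≟ i) ×-dec ¬? (j ≟ shift 3 i)

Adjacent : Fin 6 → Fin 6 → Set
Adjacent i j = j ≡ shift 1 i ⊎ i ≡ shift 1 j

_≡±_ : Fin 6 → Fin 6 → Set
i ≡± j = i ≡ j ⊎ i ≡ shift 3 j

_≡±?_ : ∀ i j → Dec (i ≡± j)
i ≡±? j = (i ≟ j) ⊎-dec (i ≟ shift 3 j)

mate : Fin 6 → Fin 6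
mate 0F = 1F
mate 1F = 0F
mate 2F = 3F
mate 3F = 2F
mate 4F = 5F
mate 5F = 4F

-- The vertex receiving position 0, and the sense of rotation.
Frame : Set
Frame = Fin 6 × Fin 2

at : Frame → Fin 6 → Fin 6
at (r , 0F) i = shift (toℕ i) r
-- The reversed sense needs minus `i` modulo 6, written `6 ∸ toℕ i` to stay within the naturals.
at (r , 1F) i = shift (6 ∸ toℕ i) r

-- Abstract, lest later definitions unfold the exhaustive searches.
abstract
  shift-3-involutive : ∀ i → shift 3 (shift 3 i) ≡ i
  shift-3-involutive = from-yes (all? λ i → shift 3 (shift 3 i) ≟ i)

  mate-involutive : ∀ i → mate (mate i) ≡ i
  mate-involutive = from-yes (all? λ i → mate (mate i) ≟ i)

  at-injective : ∀ f {i j} → at f i ≡ at f j → i ≡ j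
  at-injective (r , d) = from-yes
    (all? λ r → all? λ d → all? λ i → all? λ j →
      (at (r , d) i ≟ at (r , d) j) →-dec (i ≟ j)) r d _ _

  at-surjective : ∀ f j → ∃[ i ] at f i ≡ j
  at-surjective (r , d) = from-yes
    (all? λ r → all? λ d → all? λ j → any? λ i → at (r , d) i ≟ j) r d

  at-shift-3 : ∀ f i → shift 3 (at f i) ≡ at f (shift 3 i)
  at-shift-3 (r , d) = from-yes
    (all? λ r → all? λ d → all? λ i →
      shift 3 (at (r , d) i) ≟ at (r , d) (shift 3 i)) r d

  at-zero : ∀ r d → at (r , d) 0F ≡ r
  at-zero = from-yes (all? λ r → all? λ d → at (r , d) 0F ≟ r)

  at-mate-adjacent : ∀ f i → Adjacent (at f i) (at f (mate i))
  at-mate-adjacent (r , d) = from-yes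
    (all? λ r → all? λ d → all? λ i →
      (at (r , d) (mate i) ≟ shift 1 (at (r , d) i)) ⊎-dec
      (at (r , d) i ≟ shift 1 (at (r , d) (mate i)))) r d

  -- With the class of `i` at positions 0 and 3, the two senses of rotation exchange the other two
  -- classes, so one of them brings the class of `j` to 2 and 5.
  frame-two-classes : ∀ i j → Apart i j → ∃[ d ] at (i , d) 2F ≡± j
  frame-two-classes = from-yes
    (all? λ i → all? λ j → apart? i j →-dec any? λ d → at (i , d) 2F ≡±? j)

  -- There are only three classes, so the sense of rotation that places `j` forces `k` into the
  -- class of position 4.
  frame-three-classes : ∀ i j k → Apart i j → Apart i k → Apart j k →
    ∃[ d ] (at (i , d) 2F ≡± j × at (i , d) 4F ≡± k)
  frame-three-classes = from-yes
    (all? λ i → all? λ j → all? λ k →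
      apart? i j →-dec (apart? i k →-dec (apart? j k →-dec
        any? λ d → (at (i , d) 2F ≡±? j) ×-dec (at (i , d) 4F ≡±? k))))

-- Subsets of a finite set from decidable predicates

module _ {n} {P : Fin n → Set} (P? : ∀ x → Dec (P x)) where

  decSubset : Subset n
  decSubset = tabulate (λ x → does (P? x))

  ∈-decSubset⁺ : ∀ {x} → P x → x ∈ decSubset
  ∈-decSubset⁺ {x} p =
    lookup⇒[]= x decSubset (trans (lookup∘tabulate _ x) (dec-true (P? x) p))

  ∈-decSubset⁻ : ∀ {x} → x ∈ decSubset → P x
  ∈-decSubset⁻ {x} x∈ with P? x | trans (sym (lookup∘tabulate (λ x → does (P? x)) x)) ([]=⇒lookup x∈)
  ... | yes p | _  = p
  ... | no  _ | ()

-- Edges and their ends in coloured graphs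

module ColouredGraphProperties (G : ColouredGraph) where
  open ColouredGraph G

  -- Two different answers would make `x` both ends of `e`, and `bipartite` excludes loops.
  joins-functional : ∀ {e x y z} → Joins e x y → Joins e x z → y ≡ z
  joins-functional (inj₁ (refl , refl)) (inj₁ (_ , refl)) = refl
  joins-functional {e} (inj₁ (refl , refl)) (inj₂ (_ , q)) =
    ⊥-elim (bipartite e (cong side (sym q)))
  joins-functional {e} (inj₂ (refl , refl)) (inj₁ (p , _)) =
    ⊥-elim (bipartite e (cong side p))
  joins-functional (inj₂ (refl , refl)) (inj₂ (refl , _)) = refl

  joins-incident : ∀ {e x y} → Joins e x y → Incident x e
  joins-incident (inj₁ (p , _)) = inj₁ p
  joins-incident (inj₂ (_ , q)) = inj₂ q

  incident-joins : ∀ {e x y z} → Incident x e → Joins e y z → x ≡ y ⊎ x ≡ z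
  incident-joins (inj₁ refl) (inj₁ (p , _)) = inj₁ p
  incident-joins (inj₁ refl) (inj₂ (p , _)) = inj₂ p
  incident-joins (inj₂ refl) (inj₁ (_ , q)) = inj₂ q
  incident-joins (inj₂ refl) (inj₂ (_ , q)) = inj₁ q

  colours-distinct : ∀ {e} → Blue e → ¬ White e
  colours-distinct b w with trans (sym b) w
  ... | ()

  joins-map : ∀ {e f x y} (g : Vertex → Vertex) →
    Joins f (g (end₁ e)) (g (end₂ e)) → Joins e x y → Joins f (g x) (g y)
  joins-map g J (inj₁ (refl , refl)) = J
  joins-map g J (inj₂ (refl , refl)) = swap J

-- Pseudohexes: antipodes, white partners and links

module PseudohexProperties (K : Pseudohex) where
  open Pseudohex K
  open ColouredGraphProperties graph public

  hexagonOf-vertexAt : ∀ h i → hexagonOf (vertexAt h i) ≡ h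
  hexagonOf-vertexAt h i = cong proj₁ (Inverse.strictlyInverseʳ labelling (h , i))

  vertexAt-injective : ∀ {h h′ i j} → vertexAt h i ≡ vertexAt h′ j → h ≡ h′ × i ≡ j
  vertexAt-injective {h} {h′} {i} {j} p = cong proj₁ q , cong proj₂ q
    where
    q : (h , i) ≡ (h′ , j)
    q = trans (sym (Inverse.strictlyInverseʳ labelling (h , i)))
          (trans (cong (Inverse.from labelling) p)
            (Inverse.strictlyInverseʳ labelling (h′ , j)))

  vertexAt-hexagonOf : ∀ x → vertexAt (hexagonOf x) (indexOf x) ≡ x
  vertexAt-hexagonOf = Inverse.strictlyInverseˡ labelling

  bar-vertexAt : ∀ h i → bar (vertexAt h i) ≡ vertexAt h (shift 3 i)
  bar-vertexAt h i =
    cong (λ p → vertexAt (proj₁ p) (shift 3 (proj₂ p)))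
      (Inverse.strictlyInverseʳ labelling (h , i))

  bar-involutive : ∀ x → bar (bar x) ≡ x
  bar-involutive x =
    trans (bar-vertexAt _ _)
      (trans (cong (vertexAt _) (shift-3-involutive _)) (vertexAt-hexagonOf x))

  blueEdge : ∀ h {i j} → Adjacent i j → Edge
  blueEdge h {i} {j} (inj₁ _) = proj₁ (blue-cycles h i)
  blueEdge h {i} {j} (inj₂ _) = proj₁ (blue-cycles h j)

  blueEdge-blue : ∀ h {i j} (a : Adjacent i j) → Blue (blueEdge h a)
  blueEdge-blue h {i} {j} (inj₁ _) = proj₁ (proj₁ (proj₂ (blue-cycles h i)))
  blueEdge-blue h {i} {j} (inj₂ _) = proj₁ (proj₁ (proj₂ (blue-cycles h j)))

  blueEdge-joins : ∀ h {i j} (a : Adjacent i j) →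
    Joins (blueEdge h a) (vertexAt h i) (vertexAt h j)
  blueEdge-joins h {i} {j} (inj₁ refl) = proj₂ (proj₁ (proj₂ (blue-cycles h i)))
  blueEdge-joins h {i} {j} (inj₂ refl) = swap (proj₂ (proj₁ (proj₂ (blue-cycles h j))))

  blueEdge-unique : ∀ h {i j} (a : Adjacent i j) {e} → Blue e →
    Joins e (vertexAt h i) (vertexAt h j) → blueEdge h a ≡ e
  blueEdge-unique h {i} {j} (inj₁ refl) b J = proj₂ (proj₂ (blue-cycles h i)) (b , J)
  blueEdge-unique h {i} {j} (inj₂ refl) b J = proj₂ (proj₂ (blue-cycles h j)) (b , swap J)

  whiteEdge : Vertex → Edge
  whiteEdge x = proj₁ (white-perfect-matching x)

  whiteEdge-white : ∀ x → White (whiteEdge x)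
  whiteEdge-white x = proj₁ (proj₁ (proj₂ (white-perfect-matching x)))

  whiteEdge-unique : ∀ {x e} → White e → Incident x e → whiteEdge x ≡ e
  whiteEdge-unique {x} w i = proj₂ (proj₂ (white-perfect-matching x)) (w , i)

  opposite : ∀ {e x} → Incident x e → ∃[ y ] Joins e x y
  opposite {e} (inj₁ p) = end₂ e , inj₁ (p , refl)
  opposite {e} (inj₂ p) = end₁ e , inj₂ (refl , p)

  -- The white perfect matching as an involution on the vertices.
  partner : Vertex → Vertex
  partner x = proj₁ (opposite (proj₂ (proj₁ (proj₂ (white-perfect-matching x)))))

  whiteEdge-joins : ∀ x → Joins (whiteEdge x) x (partner x)
  whiteEdge-joins x = proj₂ (opposite (proj₂ (proj₁ (proj₂ (white-perfect-matching x)))))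

  partner-unique : ∀ {e x y} → White e → Joins e x y → partner x ≡ y
  partner-unique {e} {x} {y} w J = joins-functional (whiteEdge-joins x)
    (subst (λ e → Joins e x y) (sym (whiteEdge-unique w (joins-incident J))) J)

  partner-involutive : ∀ x → partner (partner x) ≡ x
  partner-involutive x = partner-unique (whiteEdge-white x) (swap (whiteEdge-joins x))

  partner-sym : ∀ {x y} → partner x ≡ y → partner y ≡ x
  partner-sym refl = partner-involutive _

  whiteEdge-partner : ∀ {x y} → partner x ≡ y → whiteEdge y ≡ whiteEdge x
  whiteEdge-partner {x} refl =
    whiteEdge-unique (whiteEdge-white x) (joins-incident (swap (whiteEdge-joins x)))

  -- Since `bar` is an involution, `e` is in turn the antipodal edge of `f`, and the red edges
  -- permitted at the ends of one are those permitted at the ends of the other.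
  real-bar : ∀ {e} (e-real : Real K e) → Real K (proj₁ (proj₂ e-real))
  real-bar {e} (w , f , wf , J , reds) = wf , e , w , bars J , reds′
    where
    bars : Joins f (bar (end₁ e)) (bar (end₂ e)) → IsBar K f e
    bars (inj₁ (p , q)) =
      inj₁ (trans (sym (bar-involutive _)) (cong bar (sym p)) ,
            trans (sym (bar-involutive _)) (cong bar (sym q)))
    bars (inj₂ (p , q)) =
      inj₂ (trans (sym (bar-involutive _)) (cong bar (sym q)) ,
            trans (sym (bar-involutive _)) (cong bar (sym p)))

    flip : ∀ {r x y} → bar x ≡ y → Joins r x (bar x) → Joins r y (bar y)
    flip {r} {x} refl j = swap (subst (λ z → Joins r z (bar x)) (sym (bar-involutive x)) j)

    to-bar : ∀ {r} → Joins f (bar (end₁ e)) (bar (end₂ e)) →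
      Joins r (end₁ e) (bar (end₁ e)) ⊎ Joins r (end₂ e) (bar (end₂ e)) →
      Joins r (end₁ f) (bar (end₁ f)) ⊎ Joins r (end₂ f) (bar (end₂ f))
    to-bar (inj₁ (p , q)) = Sum.map (flip (sym p)) (flip (sym q))
    to-bar (inj₂ (p , q)) s = swap (Sum.map (flip (sym q)) (flip (sym p)) s)

    reds′ : ∀ r → Red r → ShareVertex r f ⊎ ShareVertex r e →
      Joins r (end₁ f) (bar (end₁ f)) ⊎ Joins r (end₂ f) (bar (end₂ f))
    reds′ r rr s = to-bar J (reds r rr (swap s))

  -- An edge of `hexGraph` in coordinates: its two real white edges join index `i` of `h` to index
  -- `j` of `h′`, and antipode to antipode.
  record Link (h h′ : Hexagon) (i j : Fin 6) : Set where
    field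
      partner-at     : partner (vertexAt h i) ≡ vertexAt h′ j
      partner-at-bar : partner (vertexAt h (shift 3 i)) ≡ vertexAt h′ (shift 3 j)
      real           : Real K (whiteEdge (vertexAt h i))
      real-at-bar    : Real K (whiteEdge (vertexAt h (shift 3 i)))
  open Link public

  link-sym : ∀ {h h′ i j} → Link h h′ i j → Link h′ h j i
  link-sym l = record
    { partner-at     = partner-sym (partner-at l)
    ; partner-at-bar = partner-sym (partner-at-bar l)
    ; real           = subst (Real K) (sym (whiteEdge-partner (partner-at l))) (real l)
    ; real-at-bar    = subst (Real K) (sym (whiteEdge-partner (partner-at-bar l))) (real-at-bar l)
    }

  link-bar : ∀ {h h′ i j} → Link h h′ i j → Link h h′ (shift 3 i) (shift 3 j)
  link-bar {h} {h′} {i} {j} l = record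
    { partner-at     = partner-at-bar l
    ; partner-at-bar = subst₂ (λ i j → partner (vertexAt h i) ≡ vertexAt h′ j)
        (sym (shift-3-involutive i)) (sym (shift-3-involutive j)) (partner-at l)
    ; real           = real-at-bar l
    ; real-at-bar    = subst (λ i → Real K (whiteEdge (vertexAt h i)))
        (sym (shift-3-involutive i)) (real l)
    }

  -- Frames place a class only up to antipodes, so a link may have to be read from its antipodal
  -- edge.
  link-at : ∀ {h h′ i i′ j} → i′ ≡± i → Link h h′ i j → ∃[ j′ ] Link h h′ i′ j′
  link-at (inj₁ refl) l = _ , l
  link-at (inj₂ refl) l = _ , link-bar l

  -- Both white edges of a linked class lead to the same hexagon, so links to different hexagons
  -- start in different classes.
  link-apart : ∀ {h h′ h″ i i′ j j′} →
    Link h h′ i i′ → Link h h″ j j′ → h′ ≢ h″ → Apart i j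
  link-apart l m h′≢h″ =
    (λ { refl → h′≢h″ (proj₁ (vertexAt-injective
          (trans (sym (partner-at l)) (partner-at m)))) }) ,
    (λ { refl → h′≢h″ (proj₁ (vertexAt-injective
          (trans (sym (partner-at-bar l)) (partner-at m)))) })

  adjacent-link : ∀ {h h′} → Graph._~_ (hexGraph K) h h′ → ∃[ i ] ∃[ j ] Link h h′ i j
  adjacent-link (_ , e , e-real@(w , f , wf , J , _) , x , y , refl , refl , Jxy) =
    indexOf x , indexOf y , record
      { partner-at     = trans (cong partner (vertexAt-hexagonOf x))
          (trans (partner-unique w Jxy) (sym (vertexAt-hexagonOf y)))
      ; partner-at-bar = partner-unique wf Jbar
      ; real           = subst (Real K)
          (sym (trans (cong whiteEdge (vertexAt-hexagonOf x))
                      (whiteEdge-unique w (joins-incident Jxy)))) e-real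
      ; real-at-bar    = subst (Real K)
          (sym (whiteEdge-unique wf (joins-incident Jbar))) (real-bar e-real)
      }
    where
    Jbar : Joins f (bar x) (bar y)
    Jbar = joins-map bar J Jxy

-- Safe reductions from chains with one stub each

module Chains (K : Pseudohex) {k : ℕ} (hex : Fin k → Pseudohex.Hexagon K)
  (hex-injective : Injective _≡_ _≡_ hex) (frame : Fin k → Frame) where
  open Pseudohex K
  open PseudohexProperties K

  position : Fin k → Fin 6 → Vertex
  position l i = vertexAt (hex l) (at (frame l) i)

  position-injective : ∀ {l l′ i j} → position l i ≡ position l′ j → (l , i) ≡ (l′ , j)
  position-injective {l} p with vertexAt-injective p
  ... | hl≡ , ai≡ with hex-injective hl≡
  ... | refl = cong (l ,_) (at-injective (frame l) ai≡)

  hexagonOf-position : ∀ l i → hexagonOf (position l i) ≡ hex l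
  hexagonOf-position l i = hexagonOf-vertexAt _ _

  position-surjective : ∀ {l} x → hex l ≡ hexagonOf x → ∃[ i ] x ≡ position l i
  position-surjective {l} x p with at-surjective (frame l) (indexOf x)
  ... | i , q = i , trans (sym (vertexAt-hexagonOf x)) (cong₂ vertexAt (sym p) (sym q))

  mateEdge : Fin k → Fin 6 → Edge
  mateEdge l i = blueEdge (hex l) (at-mate-adjacent (frame l) i)

  mateEdge-joins : ∀ l i → Joins (mateEdge l i) (position l i) (position l (mate i))
  mateEdge-joins l i = blueEdge-joins (hex l) (at-mate-adjacent (frame l) i)

  mateEdge-mate : ∀ l i → mateEdge l (mate i) ≡ mateEdge l i
  mateEdge-mate l i = blueEdge-unique (hex l) (at-mate-adjacent (frame l) (mate i))
    (blueEdge-blue (hex l) (at-mate-adjacent (frame l) i))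
    (subst (λ j → Joins (mateEdge l i) (position l (mate i)) (position l j))
      (sym (mate-involutive i)) (swap (mateEdge-joins l i)))

  mateEdge-incident : ∀ {l l′ i j} → Incident (position l i) (mateEdge l′ j) →
    mateEdge l i ≡ mateEdge l′ j
  mateEdge-incident {l′ = l′} {j = j} x∈ with incident-joins x∈ (mateEdge-joins l′ j)
  ... | inj₁ p with position-injective p
  ... | refl = refl
  mateEdge-incident {l′ = l′} {j = j} x∈ | inj₂ p with position-injective p
  ... | refl = mateEdge-mate l′ j

  IsMateEdge : Hexagon → Edge → Set
  IsMateEdge h e = ∃[ l ] ∃[ i ] (hex l ≡ h × e ≡ mateEdge l i)

  isMateEdge? : ∀ h e → Dec (IsMateEdge h e)
  isMateEdge? h e = any? λ l → any? λ i → (hex l ≟ h) ×-dec (e ≟ mateEdge l i)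

  -- Defined on every hexagon by a finite search; outside the image of `hex` it is empty.
  N : Hexagon → Subset #edges
  N h = decSubset (isMateEdge? h)

  N-perfect : ∀ {h} → ∃[ l ] hex l ≡ h → PerfectMatchingOf K h (N h)
  N-perfect (l , refl) = edges , vertices
    where
    edges : ∀ e → e ∈ N (hex l) →
      Blue e × hexagonOf (end₁ e) ≡ hex l × hexagonOf (end₂ e) ≡ hex l
    edges e e∈ with ∈-decSubset⁻ (isMateEdge? (hex l)) e∈
    ... | l′ , i , p , refl = blueEdge-blue (hex l′) (at-mate-adjacent (frame l′) i) , ends (mateEdge-joins l′ i)
      where
      inHex : ∀ {x j} → x ≡ position l′ j → hexagonOf x ≡ hex l
      inHex q = trans (cong hexagonOf q) (trans (hexagonOf-position l′ _) p)
      ends : ∀ {e} → Joins e (position l′ i) (position l′ (mate i)) →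
        hexagonOf (end₁ e) ≡ hex l × hexagonOf (end₂ e) ≡ hex l
      ends (inj₁ (q , r)) = inHex q , inHex r
      ends (inj₂ (q , r)) = inHex q , inHex r

    vertices : ∀ x → hexagonOf x ≡ hex l → ∃[ e ] ((e ∈ N (hex l) × Incident x e) ×
      (∀ {e′} → e′ ∈ N (hex l) × Incident x e′ → e ≡ e′))
    vertices x p with position-surjective x (sym p)
    ... | i , refl = mateEdge l i ,
      (∈-decSubset⁺ (isMateEdge? (hex l)) (l , i , refl , refl) , joins-incident (mateEdge-joins l i)) ,
      unique
      where
      unique : ∀ {e′} → e′ ∈ N (hex l) × Incident (position l i) e′ → mateEdge l i ≡ e′
      unique (e′∈ , x∈) with ∈-decSubset⁻ (isMateEdge? (hex l)) e′∈
      ... | l′ , j , _ , refl = mateEdge-incident x∈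

  -- `stub l i` stands for the hexagon and position of the stub of the chain through position `i` of
  -- hexagon `l`.
  module _ (stub : Fin k → Fin 6 → Fin k × Fin 6) where

    -- The fate of the white edge at a position: only under `stop` may it be derived, `link` leads
    -- to a listed hexagon with the stub unchanged, and `exit` leaves the listed hexagons.
    data Continuation (l : Fin k) (i : Fin 6) : Set where
      stop : stub l i ≡ (l , i) → Continuation l i
      link : Real K (whiteEdge (position l i)) → ∀ l′ i′ →
        partner (position l i) ≡ position l′ i′ → stub l′ i′ ≡ stub l i → Continuation l i
      exit : Real K (whiteEdge (position l i)) →
        (∀ l′ → hex l′ ≢ hexagonOf (partner (position l i))) → Continuation l i

    module _ (stub-mate : ∀ l i → stub l (mate i) ≡ stub l i)
      (continuation : ∀ l i → Continuation l i) where

      -- A chain is named by the white edge at its stub rather than by the stub, so that two chains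
      -- joined at their stubs get the same name.
      label : Fin k → Fin 6 → Edge
      label l i = whiteEdge (uncurry position (stub l i))

      -- Contracted paths end one white edge beyond the listed hexagons, so an outside vertex
      -- inherits the label of its partner. This is a relation because all other vertices carry no
      -- label.
      data Label (x : Vertex) (e : Edge) : Set where
        inner : ∀ l i → x ≡ position l i → label l i ≡ e → Label x e
        outer : (∀ l → hex l ≢ hexagonOf x) →
          ∀ l i → partner x ≡ position l i → label l i ≡ e → Label x e

      label-functional : ∀ {x e e′} → Label x e → Label x e′ → e ≡ e′
      label-functional (inner l i p refl) (inner l′ i′ p′ refl)
        with position-injective (trans (sym p) p′)
      ... | refl = refl
      label-functional (inner l i refl _) (outer out _ _ _ _) =
        ⊥-elim (out l (sym (hexagonOf-position l i)))
      label-functional (outer out _ _ _ _) (inner l i refl _) =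
        ⊥-elim (out l (sym (hexagonOf-position l i)))
      label-functional (outer _ l i p refl) (outer _ l′ i′ p′ refl)
        with position-injective (trans (sym p) p′)
      ... | refl = refl

      label-position : ∀ {l i e} → Label (position l i) e → label l i ≡ e
      label-position x = label-functional (inner _ _ refl refl) x

      -- A link preserves the stub, an exit would contradict that the partner lies in a listed
      -- hexagon, and two stubs facing each other share their white edge.
      label-partner : ∀ l i l′ i′ → partner (position l i) ≡ position l′ i′ →
        label l i ≡ label l′ i′
      label-partner l i l′ i′ p = by (continuation l i) (continuation l′ i′)
        where
        along-link : ∀ {l i l′ i′} l″ i″ → partner (position l i) ≡ position l′ i′ →
          partner (position l i) ≡ position l″ i″ → stub l″ i″ ≡ stub l i →
          label l i ≡ label l′ i′
        along-link l″ i″ p q s with position-injective (trans (sym p) q)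
        ... | refl = cong (λ z → whiteEdge (uncurry position z)) (sym s)

        by : Continuation l i → Continuation l′ i′ → label l i ≡ label l′ i′
        by (link _ l″ i″ q s) _ = along-link l″ i″ p q s
        by (exit _ out) _ =
          ⊥-elim (out l′ (sym (trans (cong hexagonOf p) (hexagonOf-position l′ i′))))
        -- The link leads back to `(l , i)`, so the first case applies from the other end.
        by (stop _) (link _ l″ i″ q s) = sym (along-link l″ i″ (partner-sym p) q s)
        by (stop _) (exit _ out) =
          ⊥-elim (out l (sym (trans (cong hexagonOf (partner-sym p)) (hexagonOf-position l i))))
        by (stop s) (stop s′) rewrite s | s′ = sym (whiteEdge-partner p)

      label-across-white : ∀ {x e} → Label x e → Label (partner x) e
      label-across-white (outer _ l i p q) = inner l i p q
      label-across-white (inner l i refl q)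
        with any? (λ l′ → hex l′ ≟ hexagonOf (partner (position l i)))
      ... | no out = outer (λ l′ z → out (l′ , z)) l i (partner-involutive _) q
      ... | yes (l′ , z) with position-surjective _ z
      ... | i′ , p = inner l′ i′ p (trans (sym (label-partner l i l′ i′ p)) q)

      -- Matching edges join mates, which share a stub; contracted white edges join partners.
      label-step : ∀ {x y g e} →
        Contracted K (λ h → ∃[ l ] hex l ≡ h) N g → Joins g x y → Label x e → Label y e
      label-step {x} {y} {_} {e} (inj₁ (h , _ , g∈)) J lab
        with ∈-decSubset⁻ (isMateEdge? h) g∈
      ... | l , i , _ , refl with incident-joins (joins-incident J) (mateEdge-joins l i)
      ... | inj₁ refl = inner l (mate i) (joins-functional J (mateEdge-joins l i))
              (trans (cong (λ z → whiteEdge (uncurry position z)) (stub-mate l i)) (label-position lab))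
      ... | inj₂ refl = inner l i (joins-functional J (swap (mateEdge-joins l i)))
              (trans (cong (λ z → whiteEdge (uncurry position z)) (sym (stub-mate l i))) (label-position lab))
      label-step {e = e} (inj₂ (w , _)) J lab =
        subst (λ z → Label z e) (partner-unique w J) (label-across-white lab)

      label-component : ∀ {x y e} →
        Star (λ x y → ∃[ g ] (Contracted K (λ h → ∃[ l ] hex l ≡ h) N g × Joins g x y)) x y →
        Label x e → Label y e
      label-component ε lab = lab
      label-component ((_ , c , J) ◅ s) lab = label-component s (label-step c J lab)

      -- Edges under `link` and `exit` are real, so a derived contracted edge sits at a stub and is
      -- the label of its own chain.
      label-derived : ∀ {e} → Contracted K (λ h → ∃[ l ] hex l ≡ h) N e → Derived K e →
        Label (end₁ e) e
      label-derived (inj₁ (h , _ , e∈)) (w , _) with ∈-decSubset⁻ (isMateEdge? h) e∈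
      ... | l , i , _ , refl =
        ⊥-elim (colours-distinct (blueEdge-blue (hex l) (at-mate-adjacent (frame l) i)) w)
      label-derived {e} (inj₂ (w , x , (l , q) , x∈)) (_ , not-real)
        with position-surjective x q
      ... | i , refl = toEnd₁ x∈ (by (continuation l i))
        where
        e≡ : whiteEdge (position l i) ≡ e
        e≡ = whiteEdge-unique w x∈

        by : Continuation l i → Label (position l i) e
        by (stop s) = inner l i refl (trans (cong (λ z → whiteEdge (uncurry position z)) s) e≡)
        by (link r _ _ _ _) = contradiction (subst (Real K) e≡ r) not-real
        by (exit r _) = contradiction (subst (Real K) e≡ r) not-real

        -- `SameComponent` starts from `end₁`, so the label is carried across when the known vertex
        -- is `end₂`.
        toEnd₁ : ∀ {x} → Incident x e → Label x e → Label (end₁ e) e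
        toEnd₁ (inj₁ refl) lab = lab
        toEnd₁ (inj₂ refl) lab =
          subst (λ z → Label z e) (partner-unique w (inj₂ (refl , refl))) (label-across-white lab)

      -- A component carries a single label, and every derived edge in it equals that label.
      safelyReduced : CanBeSafelyReduced K (λ h → ∃[ l ] hex l ≡ h)
      safelyReduced = N , (λ _ → N-perfect) , λ e f ce cf de df same →
        label-functional (label-component same (label-derived ce de)) (label-derived cf df)

-- The forks

-- The stubs of the chains through a hexagon l other than the centre, where
-- the piece 2-3 is continued to the piece 0-1 of l′.
leafStub : ∀ {k} (l l′ : Fin k) → Fin 6 → Fin k × Fin 6
leafStub l l′ 0F = l , 1F
leafStub l l′ 1F = l , 1F
leafStub l l′ 2F = l′ , 1F
leafStub l l′ 3F = l′ , 1F
leafStub l l′ 4F = l , 4F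
leafStub l l′ 5F = l , 4F

leafStub-mate : ∀ {k} (l l′ : Fin k) i → leafStub l l′ (mate i) ≡ leafStub l l′ i
leafStub-mate l l′ 0F = refl
leafStub-mate l l′ 1F = refl
leafStub-mate l l′ 2F = refl
leafStub-mate l l′ 3F = refl
leafStub-mate l l′ 4F = refl
leafStub-mate l l′ 5F = refl

module Forks (K : Pseudohex) where
  open Pseudohex K
  open PseudohexProperties K
  open Graph (hexGraph K) using (_~_)

  -- The frame of a hexagon other than the centre: the given link starts at 0 and the link to `u` at
  -- 2, which leaves 1 and 4 for the stubs.
  exitFrame : ∀ {h h′ u i j} → Link h h′ i j → h ~ u → h′ ≢ u →
    ∃[ f ] (at f 0F ≡ i × ∃[ j′ ] Link h u (at f 2F) j′)
  exitFrame {i = i} m h~u h′≢u with adjacent-link h~u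
  ... | j , _ , n with frame-two-classes i j (link-apart m n h′≢u)
  ... | d , p = (i , d) , at-zero i d , link-at p n

  module Continuations {k} (hex : Fin k → Hexagon) (hex-injective : Injective _≡_ _≡_ hex)
    (frame : Fin k → Frame) (stub : Fin k → Fin 6 → Fin k × Fin 6) where
    open Chains K hex hex-injective frame

    Continues : Fin k → Fin 6 → Set
    Continues = Continuation stub

    link-continues : ∀ {l l′ i j} → Link (hex l) (hex l′) (at (frame l) i) (at (frame l′) j) →
      stub l′ j ≡ stub l i → Continues l i
    link-continues {l} {l′} {i} {j} m s = link (real m) l′ j (partner-at m) s

    -- The second white edge of the link settles the antipodal position.
    link-bar-continues : ∀ {l l′ i j} → Link (hex l) (hex l′) (at (frame l) i) (at (frame l′) j) →
      stub l′ (shift 3 j) ≡ stub l (shift 3 i) → Continues l (shift 3 i)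
    link-bar-continues {l} {l′} {i} {j} m =
      link-continues (subst₂ (Link (hex l) (hex l′))
        (at-shift-3 (frame l) i) (at-shift-3 (frame l′) j) (link-bar m))

    exit-continues : ∀ {l u i j} → Link (hex l) u (at (frame l) i) j →
      (∀ l′ → hex l′ ≢ u) → Continues l i
    exit-continues m out = exit (real m) λ l′ p →
      out l′ (trans p (trans (cong hexagonOf (partner-at m)) (hexagonOf-vertexAt _ _)))

    exit-bar-continues : ∀ {l u i j} → Link (hex l) u (at (frame l) i) j →
      (∀ l′ → hex l′ ≢ u) → Continues l (shift 3 i)
    exit-bar-continues {l} {u} {i} m =
      exit-continues (subst (λ i → Link (hex l) u i _) (at-shift-3 (frame l) i) (link-bar m))

  dot-safe : (hex : Fin 1 → Hexagon) → Injective _≡_ _≡_ hex → ∀ {u u′} →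
    hex 0F ~ u → hex 0F ~ u′ → u ≢ u′ →
    (∀ l → hex l ≢ u) → (∀ l → hex l ≢ u′) →
    CanBeSafelyReduced K (λ h → ∃[ l ] hex l ≡ h)
  dot-safe hex hex-injective h~u h~u′ u≢u′ out out′ with adjacent-link h~u
  ... | i , j , m with exitFrame m h~u′ u≢u′
  ... | f , refl , _ , n = safelyReduced stub (λ { 0F → leafStub-mate 0F 0F }) continues
    where
    stub : Fin 1 → Fin 6 → Fin 1 × Fin 6
    -- The piece 2-3 has no stub, both its ends leaving through real edges; the stub of 0-1 serves
    -- as a default.
    stub l = leafStub l l

    open Chains K hex hex-injective (λ _ → f)
    open Continuations hex hex-injective (λ _ → f) stub

    continues : ∀ l i → Continues l i
    continues 0F 0F = exit-continues m out
    continues 0F 1F = stop refl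
    continues 0F 2F = exit-continues n out′
    continues 0F 3F = exit-bar-continues m out
    continues 0F 4F = stop refl
    continues 0F 5F = exit-bar-continues n out′

  subfork-safe : (hex : Fin 2 → Hexagon) → Injective _≡_ _≡_ hex → (u : Fin 2 → Hexagon) →
    hex 0F ~ hex 1F → (∀ l → hex l ~ u l) → (∀ l j → hex l ≢ u j) →
    CanBeSafelyReduced K (λ h → ∃[ l ] hex l ≡ h)
  subfork-safe hex hex-injective u h~h′ h~u out with adjacent-link h~h′
  -- The second frame is built on the antipodal edge of the link: `shift 3 j` gets position 0, hence
  -- `j` gets 3, so that 0 meets 3.
  ... | i , j , m with exitFrame m (h~u 0F) (out 1F 0F)
                     | exitFrame (link-sym (link-bar m)) (h~u 1F) (out 0F 1F)
  ... | f , refl , _ , n | f′ , p , _ , n′ =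
    safelyReduced stub (λ { 0F → leafStub-mate 0F 1F ; 1F → leafStub-mate 1F 0F }) continues
    where
    frame : Fin 2 → Frame
    frame 0F = f
    frame 1F = f′

    stub : Fin 2 → Fin 6 → Fin 2 × Fin 6
    stub 0F = leafStub 0F 1F
    stub 1F = leafStub 1F 0F

    open Chains K hex hex-injective frame
    open Continuations hex hex-injective frame stub

    m′ : Link (hex 0F) (hex 1F) (at f 0F) (at f′ 3F)
    m′ = subst (Link (hex 0F) (hex 1F) (at f 0F))
      (trans (sym (shift-3-involutive j))
        (trans (cong (shift 3) (sym p)) (at-shift-3 f′ 0F))) m

    continues : ∀ l i → Continues l i
    continues 0F 0F = link-continues {l′ = 1F} {j = 3F} m′ refl
    continues 0F 1F = stop refl
    continues 0F 2F = exit-continues n (λ l → out l 0F)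
    continues 0F 3F = link-bar-continues {l′ = 1F} {j = 3F} m′ refl
    continues 0F 4F = stop refl
    continues 0F 5F = exit-bar-continues n (λ l → out l 0F)
    continues 1F 0F = link-bar-continues {i = 3F} {j = 0F} (link-sym m′) refl
    continues 1F 1F = stop refl
    continues 1F 2F = exit-continues n′ (λ l → out l 1F)
    continues 1F 3F = link-continues {j = 0F} (link-sym m′) refl
    continues 1F 4F = stop refl
    continues 1F 5F = exit-bar-continues n′ (λ l → out l 1F)

  -- One position from each antipodal class; the antipode of `even m` is 2m + 3 modulo 6.
  even : Fin 3 → Fin 6
  even 0F = 0F
  even 1F = 2F
  even 2F = 4F

  -- Links to three distinct leaves occupy all three classes, which a frame can put in the required
  -- order; `link-at` then turns each link to its even end.
  centreFrame : ∀ {h} (h′ : Fin 3 → Hexagon) → Injective _≡_ _≡_ h′ → (∀ m → h ~ h′ m) →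
    ∃[ f ] (∀ m → ∃[ j ] Link h (h′ m) (at f (even m)) j)
  centreFrame {h} h′ h′-injective h~h′
    with adjacent-link (h~h′ 0F) | adjacent-link (h~h′ 1F) | adjacent-link (h~h′ 2F)
  ... | i , i′ , a | j , j′ , b | k , k′ , c
    with frame-three-classes i j k
      (link-apart a b (λ p → contradiction (h′-injective p) λ ()))
      (link-apart a c (λ p → contradiction (h′-injective p) λ ()))
      (link-apart b c (λ p → contradiction (h′-injective p) λ ()))
  ... | d , p , q = (i , d) , λ
    { 0F → link-at (inj₁ (at-zero i d)) a
    ; 1F → link-at p b
    ; 2F → link-at q c
    }

  -- Modulo 6, the piece 2-3 of leaf `m` enters the centre at 2m + 3, crosses to the mate 2m + 2 and
  -- arrives at the piece 0-1 of leaf `next m`.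
  next : Fin 3 → Fin 3
  next 0F = 1F
  next 1F = 2F
  next 2F = 0F

  -- All three classes of the centre lead to leaves, so the centre has no stub and each of its
  -- matching edges connects two different leaves.
  starFork-safe : (hex : Fin 4 → Hexagon) → Injective _≡_ _≡_ hex → (u : Fin 3 → Hexagon) →
    (∀ m → hex 0F ~ hex (suc m)) → (∀ m → hex (suc m) ~ u m) → (∀ l m → hex l ≢ u m) →
    CanBeSafelyReduced K (λ h → ∃[ l ] hex l ≡ h)
  starFork-safe hex hex-injective u c~h h~u out =
    safelyReduced stub stub-mate continues
    where
    centre : ∃[ f ] (∀ m → ∃[ j ] Link (hex 0F) (hex (suc m)) (at f (even m)) j)
    centre = centreFrame (λ m → hex (suc m)) (λ p → suc-injective (hex-injective p)) c~h

    leaf : ∀ m → ∃[ f ] (at f 0F ≡ proj₁ (proj₂ centre m) ×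
      ∃[ j ] Link (hex (suc m)) (u m) (at f 2F) j)
    leaf m = exitFrame (link-sym (proj₂ (proj₂ centre m))) (h~u m) (out 0F m)

    frame : Fin 4 → Frame
    frame 0F      = proj₁ centre
    frame (suc m) = proj₁ (leaf m)

    -- The mate of position 2m + 3 of the centre is the even position linked
    -- to leaf m + 1.
    stub : Fin 4 → Fin 6 → Fin 4 × Fin 6
    stub 0F 0F = 1F , 1F
    stub 0F 1F = 1F , 1F
    stub 0F 2F = 2F , 1F
    stub 0F 3F = 2F , 1F
    stub 0F 4F = 3F , 1F
    stub 0F 5F = 3F , 1F
    stub (suc m) = leafStub (suc m) (suc (next m))

    stub-mate : ∀ l i → stub l (mate i) ≡ stub l i
    stub-mate 0F 0F = refl
    stub-mate 0F 1F = refl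
    stub-mate 0F 2F = refl
    stub-mate 0F 3F = refl
    stub-mate 0F 4F = refl
    stub-mate 0F 5F = refl
    stub-mate (suc m) = leafStub-mate (suc m) (suc (next m))

    open Chains K hex hex-injective frame
    open Continuations hex hex-injective frame stub

    spoke : ∀ m → Link (hex 0F) (hex (suc m)) (at (frame 0F) (even m)) (at (frame (suc m)) 0F)
    spoke m = subst (Link (hex 0F) (hex (suc m)) (at (frame 0F) (even m)))
      (sym (proj₁ (proj₂ (leaf m)))) (proj₂ (proj₂ centre m))

    exitLink : ∀ m → Link (hex (suc m)) (u m) (at (frame (suc m)) 2F) _
    exitLink m = proj₂ (proj₂ (proj₂ (leaf m)))

    even-stub : ∀ m → stub 0F (even m) ≡ (suc m , 1F)
    even-stub 0F = refl
    even-stub 1F = refl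
    even-stub 2F = refl

    odd-stub : ∀ m → stub 0F (shift 3 (even m)) ≡ (suc (next m) , 1F)
    odd-stub 0F = refl
    odd-stub 1F = refl
    odd-stub 2F = refl

    continues : ∀ l i → Continues l i
    continues 0F 0F = link-continues {l′ = 1F} {j = 0F} (spoke 0F) refl
    -- The odd positions 1, 3 and 5 are the antipodes of 4, 0 and 2, where spokes 2, 0 and 1 start.
    continues 0F 1F = link-bar-continues {i = 4F} {j = 0F} (spoke 2F) refl
    continues 0F 2F = link-continues {l′ = 2F} {j = 0F} (spoke 1F) refl
    continues 0F 3F = link-bar-continues {i = 0F} {j = 0F} (spoke 0F) refl
    continues 0F 4F = link-continues {l′ = 3F} {j = 0F} (spoke 2F) refl
    continues 0F 5F = link-bar-continues {i = 2F} {j = 0F} (spoke 1F) refl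
    continues (suc m) 0F = link-continues {l′ = 0F} {j = even m} (link-sym (spoke m)) (even-stub m)
    continues (suc m) 1F = stop refl
    continues (suc m) 2F = exit-continues (exitLink m) (λ l → out l m)
    continues (suc m) 3F = link-bar-continues {l′ = 0F} {i = 0F} {j = even m} (link-sym (spoke m)) (odd-stub m)
    continues (suc m) 4F = stop refl
    continues (suc m) 5F = exit-bar-continues (exitLink m) (λ l → out l m)

-- Graph addition: the added and the attached vertices

module _ {G′ L G B} (A : Addition G′ L B G) where
  open Addition A
  open HalfEdges B using (count) renaming (at to end)
  private module G = Graph G

  added : Graph.Vertex L → G.Vertex
  added l = _≅_.to iso (inj₂ l)

  attached : Fin count → G.Vertex
  attached j = _≅_.to iso (inj₁ (attach j))

  private
    to-injective : ∀ {x y} → _≅_.to iso x ≡ _≅_.to iso y → x ≡ y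
    to-injective {x} {y} p =
      trans (sym (Inverse.strictlyInverseʳ (_≅_.vertices iso) x))
        (trans (cong (Inverse.from (_≅_.vertices iso)) p)
          (Inverse.strictlyInverseʳ (_≅_.vertices iso) y))

  added-injective : Injective _≡_ _≡_ added
  added-injective p with to-injective p
  ... | refl = refl

  attached-injective : Injective _≡_ _≡_ attached
  attached-injective p = distinct (inj₁-injective (to-injective p))

  added≢attached : ∀ l j → added l ≢ attached j
  added≢attached l j p with to-injective p
  ... | ()

  added-adjacent : ∀ {l l′} → Graph._~_ L l l′ → added l G.~ added l′
  added-adjacent = Equivalence.to (_≅_.adjacency iso _ _)

  added~attached : ∀ j → added (end j) G.~ attached j
  added~attached j = Equivalence.to (_≅_.adjacency iso (inj₂ (end j)) (inj₁ (attach j))) (j , refl , refl)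

mainTheorem7 : (L : Fork) (K K′ : Pseudohex) → Proper K → Proper K′ →
    (A : ForkAddition L K K′) →
    CanBeSafelyReduced K (ForkAddition.addedHexagons A)
mainTheorem7 _ K _ _ _ record { bold = bold-starFork ; addition = A } =
  starFork-safe (added A) (added-injective A) (attached A)
    (λ m → added-adjacent A (centre-leaf m)) (added~attached A) (added≢attached A)
  where open Forks K
mainTheorem7 _ K _ _ _ record { bold = bold-subfork ; addition = A } =
  subfork-safe (added A) (added-injective A) (attached A)
    (added-adjacent A λ ()) (added~attached A) (added≢attached A)
  where open Forks K
mainTheorem7 _ K _ _ _ record { bold = bold-dot₂ ; addition = A } =
  dot-safe (added A) (added-injective A) (added~attached A 0F) (added~attached A 1F)
    (λ p → contradiction (attached-injective A p) λ ())
    (λ l → added≢attached A l 0F) (λ l → added≢attached A l 1F)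
  where open Forks K
-- The class leading to the third neighbour is left at 1 and 4, where it plays the part of the
-- stubs.
mainTheorem7 _ K _ _ _ record { bold = bold-dot₃ ; addition = A } =
  dot-safe (added A) (added-injective A) (added~attached A 0F) (added~attached A 1F)
    (λ p → contradiction (attached-injective A p) λ ())
    (λ l → added≢attached A l 0F) (λ l → added≢attached A l 1F)
  where open Forks K
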